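{- Let $G_1$ and $G_2$ be simple graphs with node sets $V_1=\{1,\dots,n\}$ and $V_2=\{1,\dots,m\}$ and edge sets $E_1,E_2$. Let $\mathbf D$ be the $(n+m)^2\times(n+m)^2$ edge-cost matrix and $\mathbf c=\mathrm{vec}(\mathbf C)$ the node-cost vector defined in the context, and let $\Delta=\mathbf D$ if both $G_1$ and $G_2$ are undirected and $\Delta=\mathbf D+\mathbf D^T$ otherwise (so that $\Delta$ is symmetric). Then: (i) for every $(n+m)\times(m+n)$ permutation matrix $\mathbf X$ with vectorization $\mathbf x=\mathrm{vec}(\mathbf X)$, if the value $\tfrac12\mathbf x^T\Delta\mathbf x+\mathbf c^T\mathbf x$ is not infinite, then it is equal to the cost $\gamma(P)$ of some restricted edit path $P$ from $G_1$ to $G_2$; (ii) conversely, for every restricted edit path $P$ from $G_1$ to $G_2$ there is an $(n+m)\times(m+n)$ permutation matrix $\mathbf X$ such that, with $\mathbf x=\mathrm{vec}(\mathbf X)$, $\gamma(P)=\tfrac12\mathbf x^T\Delta\mathbf x+\mathbf c^T\mathbf x$.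
   Context: Graphs. A simple graph has a finite node set $V$ and an edge set $E\subseteq V\times V$ of ordered couples without self-loops ($(i,i)\notin E$). It may carry a node labeling $V\to\mathcal L$ and an edge labeling $E\to\mathcal L$, with $\mathcal L$ a finite alphabet. It is undirected if $(i,j)\in E$ implies $(j,i)\in E$ (with the same label if labeled). Costs. All elementary costs are real and non-negative: $c_{vs}(i\to k)$ (substituting node $i\in V_1$ by $k\in V_2$), $c_{vd}(i)$ (removing $i\in V_1$), $c_{vi}(k)$ (inserting $k\in V_2$), $c_{es}((i,j)\to(k,l))$, $c_{ed}(i,j)$, $c_{ei}(k,l)$ (same for edges $(i,j)\in E_1$, $(k,l)\in E_2$). A substitution between identical labels (or in unlabeled graphs) costs $0$. When $G_1$ and $G_2$ are both undirected, $(i,j)$ and $(j,i)$ encode a single edge, so $c_{es}((i,j)\to(k,l))=c_{es}((j,i)\to(l,k))$, $c_{ed}(i,j)=c_{ed}(j,i)$, $c_{ei}(k,l)=c_{ei}(l,k)$. Restricted edit paths. Regarded up to the order of its operations, and with every unchanged element regarded as substituted at zero cost, a restricted edit path from $G_1$ to $G_2$ is a set $P$ of operations of the form: node substitution $i\to k$, node removal $i\to\epsilon$, node insertion $\epsilon\to k$ ($i\in V_1,k\in V_2$); edge substitution $(i,j)\to(k,l)$, edge removal $(i,j)\to\epsilon$, edge insertion $\epsilon\to(k,l)$ ($(i,j)\in E_1$, $(k,l)\in E_2$); such that (a) each $i\in V_1$ and each $(i,j)\in E_1$ is involved in exactly one operation (a removal or a substitution), and each $k\in V_2$ and each $(k,l)\in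 E_2$ is involved in exactly one operation (an insertion or a substitution); (b) if $(i,j)\to(k,l)$ is in $P$ then $i\to k$ and $j\to l$ are in $P$; (c) no edge is removed and then inserted: if $i\to k$, $j\to l$ and $(i,j)\to\epsilon$ are in $P$ with $(k,l)\in E_2$, then $\epsilon\to(k,l)$ is not in $P$. The cost $\gamma(P)$ is the sum of the costs of all node operations plus the sum of the costs of all edge operations, where, when $G_1$ and $G_2$ are both undirected, the sum over edge operations (indexed by ordered couples) is multiplied by $\tfrac12$, so that each undirected edge is counted once. Augmented sets. $V_1^\epsilon=V_1\cup\{\epsilon_1,\dots,\epsilon_m\}$ and $V_2^\epsilon=V_2\cup\{\epsilon_1,\dots,\epsilon_n\}$, both of size $n+m$ ($\epsilon_1,\dots,\epsilon_m$ are identified with $n+1,\dots,n+m$ in $V_1^\epsilon$, and $\epsilon_1,\dots,\epsilon_n$ with $m+1,\dots,m+n$ in $V_2^\epsilon$). Rows of $\mathbf X$ and $\mathbf C$ are indexed by $V_1^\epsilon$ and columns by $V_2^\epsilon$; $\mathrm{vec}$ concatenates rows, so $\mathbf x$ and $\mathbf c$ are indexed by pairs $ik\in V_1^\epsilon\times V_2^\epsilon$. A mapping $i\to\epsilon_j$ with $i\in V_1$, $j\neq i$, or $\epsilon_k\to l$ with $l\in V_2$, $k\ne l$, is called forbidden; all other mappings from an element of $V_1^\epsilon$ to an element of $V_2^\epsilon$ are allowed. Forbidden mappings get the cost $\omega=+\infty$, with the convention $0\cdot\infty=0$. Node cost matrix. $\mathbf C_{i,k}=c_{vs}(i\to k)$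 for $i\in V_1,k\in V_2$; $\mathbf C_{i,\epsilon_i}=c_{vd}(i)$; $\mathbf C_{\epsilon_k,k}=c_{vi}(k)$; $\mathbf C_{\epsilon_k,\epsilon_i}=0$; $\omega$ for forbidden mappings. Edge cost matrix. For $i,j\in V_1^\epsilon$ and $k,l\in V_2^\epsilon$: $d_{ik,jl}=\omega$ if $i\to k$ or $j\to l$ is forbidden, and otherwise $$d_{ik,jl}=c_{es}((i,j)\to(k,l))\,\delta_{(i,j)\in E_1}\delta_{(k,l)\in E_2}+c_{ed}(i,j)\,\delta_{(i,j)\in E_1}(1-\delta_{(k,l)\in E_2})+c_{ei}(k,l)\,(1-\delta_{(i,j)\in E_1})\delta_{(k,l)\in E_2},$$ where $\delta_{e\in E}=1$ if $e\in E$ and $0$ otherwise (pairs involving a dummy element are never edges). $\mathbf D=(d_{ik,jl})$ with rows indexed by $ik$ and columns by $jl$. -}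

module Defs where

open import Level using (Level; suc; _⊔_)
open import Algebra.Apartness.Bundles using (HeytingField; HeytingCommutativeRing)
open import Algebra.Bundles.Raw using (RawMonoid)
open import Algebra.Bundles using (CommutativeRing)
import Algebra.Definitions.RawMonoid as RawMonoidDefinitions
open import Data.Bool using (Bool; false; true; T; T?; if_then_else_; _∨_; not)
open import Data.Fin using (Fin; splitAt; _≟_)
open import Data.Fin.Properties using (all?)
open import Data.Maybe using (Maybe; just; nothing; map)
import Data.Maybe.Properties as Maybe
open import Data.Nat using (ℕ)
import Data.Nat as ℕ
import Data.Nat.Properties as ℕ
open import Data.Product using (_×_; _,_; ∃!; proj₁; swap)
open import Data.Sum using (_⊎_; inj₁; inj₂)
open import Data.Unit using (⊤)
open import Data.Vec.Functional using (Vector; concat; transpose)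
open import Function using (_⇔_)
open import Function.Bundles using (Equivalence)
open import Relation.Binary using (Rel; IsStrictPartialOrder)
import Relation.Binary.Construct.Add.Supremum.Equality as SupremumEquality
open import Relation.Binary.PropositionalEquality using (_≡_)
open import Relation.Nullary using (¬_; Dec; does; _×-dec_; _→-dec_)
open import Relation.Nullary.Construct.Add.Supremum using (_⁺; ⊤⁺; [_])

-- Only the ordered-field structure of the reals is used, so the costs
-- live in an arbitrary ordered field. The axioms are stated through
-- apartness and strict order because these hold for the constructive
-- reals; classically, with _#_ as inequality, they are the usual ones.

record OrderedField (c ℓ₁ ℓ₂ ℓ₃ : Level) : Set (suc (c ⊔ ℓ₁ ⊔ ℓ₂ ⊔ ℓ₃)) where
  infix 4 _<_ _≤_
  field
    heytingField : HeytingField c ℓ₁ ℓ₂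

  open HeytingField heytingField public
  open HeytingCommutativeRing heytingCommutativeRing public
    using (commutativeRing)

  field
    _<_                  : Rel Carrier ℓ₃
    isStrictPartialOrder : IsStrictPartialOrder _≈_ _<_
    #⇔<⊎>                : ∀ {x y} → x # y ⇔ (x < y ⊎ y < x)
    0<1                  : 0# < 1#
    +-monoʳ-<            : ∀ x {y z} → y < z → x + y < x + z
    *-pos                : ∀ {x y} → 0# < x → 0# < y → 0# < x * y

  _≤_ : Rel Carrier ℓ₃
  x ≤ y = ¬ (y < x)

  private
    module < = IsStrictPartialOrder isStrictPartialOrder

    0<2 : 0# < 1# + 1#
    0<2 = <.trans 0<1 (<.<-respˡ-≈ (+-identityʳ 1#) (+-monoʳ-< 1# 0<1))

  ½ : Carrier
  ½ = proj₁ (#⇒invertible (Equivalence.from #⇔<⊎> (inj₂ 0<2)))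

Matrix : ∀ {a} → Set a → ℕ → ℕ → Set a
Matrix A r s = Vector (Vector A s) r

module _ where
  open RawMonoidDefinitions ℕ.+-0-rawMonoid using (sum)

  IsPermutationMatrix : ∀ {r s} → Matrix ℕ r s → Set
  IsPermutationMatrix X =
    (∀ i k → X i k ≡ 0 ⊎ X i k ≡ 1) ×
    (∀ i → sum (X i) ≡ 1) ×
    (∀ k → sum (transpose X k) ≡ 1)

Couple : ℕ → Set
Couple n = Fin n × Fin n

-- The labels come from an alphabet of q letters. Edge labels are only
-- meaningful on edges.

record Graph (n q : ℕ) : Set where
  field
    isEdge      : Couple n → Bool
    irreflexive : ∀ i → ¬ T (isEdge (i , i))
    nodeLabels  : Maybe (Fin n → Fin q)
    edgeLabels  : Maybe (Couple n → Fin q)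

  -- nothing for an unlabeled graph.
  nodeLabel : Fin n → Maybe (Fin q)
  nodeLabel i = map (λ f → f i) nodeLabels

  edgeLabel : Couple n → Maybe (Fin q)
  edgeLabel e = map (λ f → f e) edgeLabels

  Edge : Couple n → Set
  Edge e = T (isEdge e)

  Undirected : Set
  Undirected = ∀ i j → Edge (i , j) →
    Edge (j , i) × edgeLabel (i , j) ≡ edgeLabel (j , i)

  undirected? : Dec Undirected
  undirected? = all? λ i → all? λ j → T? (isEdge (i , j)) →-dec
    (T? (isEdge (j , i)) ×-dec
     Maybe.≡-dec _≟_ (edgeLabel (i , j)) (edgeLabel (j , i)))

data Element (n : ℕ) : Set where
  node   : Fin n → Element n
  couple : Couple n → Element n

_∋_ : ∀ {n q} → Graph n q → Element n → Set
G ∋ node i   = ⊤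
G ∋ couple e = Graph.Edge G e

data Operation (n m : ℕ) : Set where
  substituteNode : Fin n → Fin m → Operation n m
  removeNode     : Fin n → Operation n m
  insertNode     : Fin m → Operation n m
  substituteEdge : Couple n → Couple m → Operation n m
  removeEdge     : Couple n → Operation n m
  insertEdge     : Couple m → Operation n m

module _ {n m : ℕ} where

  -- The element of the first (second) graph involved in an operation.
  source : Operation n m → Maybe (Element n)
  source (substituteNode i k) = just (node i)
  source (removeNode i)       = just (node i)
  source (insertNode k)       = nothing
  source (substituteEdge e f) = just (couple e)
  source (removeEdge e)       = just (couple e)
  source (insertEdge f)       = nothing

  target : Operation n m → Maybe (Element m)
  target (substituteNode i k) = just (node k)
  target (removeNode i)       = nothing
  target (insertNode k)       = just (node k)
  target (substituteEdge e f) = just (couple f)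
  target (removeEdge e)       = nothing
  target (insertEdge f)       = just (couple f)

record RestrictedEditPath {n m q} (G₁ : Graph n q) (G₂ : Graph m q) : Set where
  infix 4 _∈P
  field
    member : Operation n m → Bool

  _∈P : Operation n m → Set
  o ∈P = T (member o)

  field
    sources-valid : ∀ {o x} → o ∈P → source o ≡ just x → G₁ ∋ x
    targets-valid : ∀ {o y} → o ∈P → target o ≡ just y → G₂ ∋ y
    sources-once  : ∀ x → G₁ ∋ x → ∃! _≡_ λ o → o ∈P × source o ≡ just x
    targets-once  : ∀ y → G₂ ∋ y → ∃! _≡_ λ o → o ∈P × target o ≡ just y
    endpoints     : ∀ {i j k l} → substituteEdge (i , j) (k , l) ∈P →
                    substituteNode i k ∈P × substituteNode j l ∈P
    no-reinsert   : ∀ {i j k l} →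
                    substituteNode i k ∈P → substituteNode j l ∈P →
                    removeEdge (i , j) ∈P → Graph.Edge G₂ (k , l) →
                    ¬ insertEdge (k , l) ∈P

-- The edge costs are total functions for convenience; they are only
-- constrained, and only ever used, on edges.

record Costs {c ℓ₁ ℓ₂ ℓ₃} (F : OrderedField c ℓ₁ ℓ₂ ℓ₃)
             {n m q} (G₁ : Graph n q) (G₂ : Graph m q) :
             Set (c ⊔ ℓ₁ ⊔ ℓ₃) where
  open OrderedField F
  private
    module G₁ = Graph G₁
    module G₂ = Graph G₂
  field
    cvs : Fin n → Fin m → Carrier
    cvd : Fin n → Carrier
    cvi : Fin m → Carrier
    ces : Couple n → Couple m → Carrier
    ced : Couple n → Carrier
    cei : Couple m → Carrier

    cvs-nonneg : ∀ i k → 0# ≤ cvs i k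
    cvd-nonneg : ∀ i → 0# ≤ cvd i
    cvi-nonneg : ∀ k → 0# ≤ cvi k
    ces-nonneg : ∀ e f → G₁.Edge e → G₂.Edge f → 0# ≤ ces e f
    ced-nonneg : ∀ e → G₁.Edge e → 0# ≤ ced e
    cei-nonneg : ∀ f → G₂.Edge f → 0# ≤ cei f

    cvs-identical : ∀ i k → G₁.nodeLabel i ≡ G₂.nodeLabel k → cvs i k ≈ 0#
    ces-identical : ∀ e f → G₁.Edge e → G₂.Edge f →
                    G₁.edgeLabel e ≡ G₂.edgeLabel f → ces e f ≈ 0#

    ces-sym : G₁.Undirected → G₂.Undirected →
              ∀ e f → G₁.Edge e → G₂.Edge f → ces e f ≈ ces (swap e) (swap f)
    ced-sym : G₁.Undirected → G₂.Undirected →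
              ∀ e → G₁.Edge e → ced e ≈ ced (swap e)
    cei-sym : G₁.Undirected → G₂.Undirected →
              ∀ f → G₂.Edge f → cei f ≈ cei (swap f)

-- ⊤⁺ is the cost ω = +∞ of forbidden mappings.

module Extended {c ℓ₁ ℓ₂ ℓ₃} (F : OrderedField c ℓ₁ ℓ₂ ℓ₃) where
  open OrderedField F
  open SupremumEquality _≈_ public using (_≈⁺_)

  infixl 6 _+⁺_
  _+⁺_ : Carrier ⁺ → Carrier ⁺ → Carrier ⁺
  [ x ] +⁺ [ y ] = [ x + y ]
  [ x ] +⁺ ⊤⁺    = ⊤⁺
  ⊤⁺    +⁺ y     = ⊤⁺

  half : Carrier ⁺ → Carrier ⁺
  half [ x ] = [ ½ * x ]
  half ⊤⁺    = ⊤⁺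

  +⁺-rawMonoid : RawMonoid c (c ⊔ ℓ₁)
  +⁺-rawMonoid = record { _≈_ = _≈⁺_ ; _∙_ = _+⁺_ ; ε = [ 0# ] }

  -- n · x is the n-fold sum of x, so that 0 · ⊤⁺ = [ 0# ], 1 · ⊤⁺ = ⊤⁺.
  open RawMonoidDefinitions +⁺-rawMonoid public
    using () renaming (_×_ to infixr 8 _·_; sum to sum⁺)

  -- xᵀ v and A x, for x with entries 0 and 1.
  dot : ∀ {r} → Vector ℕ r → Vector (Carrier ⁺) r → Carrier ⁺
  dot x v = sum⁺ λ p → x p · v p

  mulVec : ∀ {r s} → Matrix (Carrier ⁺) r s → Vector ℕ s → Vector (Carrier ⁺) r
  mulVec A x p = dot x (A p)

module EditDistance {c ℓ₁ ℓ₂ ℓ₃} (F : OrderedField c ℓ₁ ℓ₂ ℓ₃)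
                    {n m q} (G₁ : Graph n q) (G₂ : Graph m q)
                    (𝒞 : Costs F G₁ G₂) where
  open OrderedField F
  open Extended F public
  open Costs 𝒞
  open RawMonoidDefinitions (CommutativeRing.+-rawMonoid commutativeRing)
    using (sum)
  private
    module G₁ = Graph G₁
    module G₂ = Graph G₂

  bothUndirected? : Dec (G₁.Undirected × G₂.Undirected)
  bothUndirected? = G₁.undirected? ×-dec G₂.undirected?

  -- V₁ᵋ and V₂ᵋ, with the dummy elements last: ε_k ∈ V₁ᵋ is inj₂ k
  -- (k : Fin m), and ε_i ∈ V₂ᵋ is inj₂ i (i : Fin n).
  V₁ᵋ V₂ᵋ : Set
  V₁ᵋ = Fin n ⊎ Fin m
  V₂ᵋ = Fin m ⊎ Fin n

  forbidden : V₁ᵋ → V₂ᵋ → Bool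
  forbidden (inj₁ i) (inj₂ j) = not (does (i ≟ j))
  forbidden (inj₂ k) (inj₁ l) = not (does (k ≟ l))
  forbidden (inj₁ _) (inj₁ _) = false
  forbidden (inj₂ _) (inj₂ _) = false

  allowedNodeCost : V₁ᵋ → V₂ᵋ → Carrier
  allowedNodeCost (inj₁ i) (inj₁ k) = cvs i k
  allowedNodeCost (inj₁ i) (inj₂ _) = cvd i
  allowedNodeCost (inj₂ _) (inj₁ l) = cvi l
  allowedNodeCost (inj₂ _) (inj₂ _) = 0#

  nodeCost : V₁ᵋ → V₂ᵋ → Carrier ⁺
  nodeCost i k = if forbidden i k then ⊤⁺ else [ allowedNodeCost i k ]

  -- just (i , j) if (i , j) is an edge, nothing otherwise; in particular
  -- for pairs involving a dummy element.
  edge₁ : V₁ᵋ → V₁ᵋ → Maybe (Couple n)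
  edge₁ (inj₁ i) (inj₁ j) = if G₁.isEdge (i , j) then just (i , j) else nothing
  edge₁ _        _        = nothing

  edge₂ : V₂ᵋ → V₂ᵋ → Maybe (Couple m)
  edge₂ (inj₁ k) (inj₁ l) = if G₂.isEdge (k , l) then just (k , l) else nothing
  edge₂ _        _        = nothing

  -- At most one of the three δ-weighted terms of d is nonzero, according
  -- to which of the two pairs are edges.
  allowedEdgeCost : Maybe (Couple n) → Maybe (Couple m) → Carrier
  allowedEdgeCost (just e) (just f) = ces e f
  allowedEdgeCost (just e) nothing  = ced e
  allowedEdgeCost nothing  (just f) = cei f
  allowedEdgeCost nothing  nothing  = 0#

  edgeCost : V₁ᵋ → V₂ᵋ → V₁ᵋ → V₂ᵋ → Carrier ⁺
  edgeCost i k j l =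
    if forbidden i k ∨ forbidden j l then ⊤⁺
    else [ allowedEdgeCost (edge₁ i j) (edge₂ k l) ]

  N : ℕ
  N = (n ℕ.+ m) ℕ.* (m ℕ.+ n)

  vec : ∀ {a} {A : Set a} → Matrix A (n ℕ.+ m) (m ℕ.+ n) → Vector A N
  vec = concat

  C : Matrix (Carrier ⁺) (n ℕ.+ m) (m ℕ.+ n)
  C i k = nodeCost (splitAt n i) (splitAt m k)

  D : Matrix (Carrier ⁺) N N
  D = vec λ i k → vec λ j l →
    edgeCost (splitAt n i) (splitAt m k) (splitAt n j) (splitAt m l)

  Δ : Matrix (Carrier ⁺) N N
  Δ p r = if does bothUndirected? then D p r else D p r +⁺ transpose D p r

  objective : Matrix ℕ (n ℕ.+ m) (m ℕ.+ n) → Carrier ⁺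
  objective X = half (dot x (mulVec Δ x)) +⁺ dot x (vec C)
    where x = vec X

  cost : Operation n m → Carrier
  cost (substituteNode i k) = cvs i k
  cost (removeNode i)       = cvd i
  cost (insertNode k)       = cvi k
  cost (substituteEdge e f) = ces e f
  cost (removeEdge e)       = ced e
  cost (insertEdge f)       = cei f

  sumCouples : ∀ {r} → (Couple r → Carrier) → Carrier
  sumCouples f = sum λ i → sum λ j → f (i , j)

  module _ (P : RestrictedEditPath G₁ G₂) where
    open RestrictedEditPath P using (member)

    costInP : Operation n m → Carrier
    costInP o = if member o then cost o else 0#

    nodeOperationsCost : Carrier
    nodeOperationsCost =
      (sum λ i → sum λ k → costInP (substituteNode i k)) +
      (sum λ i → costInP (removeNode i)) +
      (sum λ k → costInP (insertNode k))

    edgeOperationsCost : Carrier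
    edgeOperationsCost =
      (sumCouples λ e → sumCouples λ f → costInP (substituteEdge e f)) +
      (sumCouples λ e → costInP (removeEdge e)) +
      (sumCouples λ f → costInP (insertEdge f))

    γ : Carrier
    γ = nodeOperationsCost +
        (if does bothUndirected? then ½ * edgeOperationsCost
         else edgeOperationsCost)

module Submission where

open import Defs
open import Data.Nat using (ℕ; _+_)
open import Data.Product using (_×_; ∃-syntax)
open import Relation.Binary.PropositionalEquality using (_≢_)
open import Relation.Nullary.Construct.Add.Supremum using (⊤⁺; [_])

open import Algebra.Bundles using (CommutativeMonoid; CommutativeRing)
import Algebra.Properties.CommutativeMonoid.Sum as Sums
import Algebra.Definitions.RawMonoid as RawMonoidDefinitions
open import Data.Bool using (Bool; true; false; T; T?; if_then_else_; _∧_; _∨_; not)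
open import Data.Bool.Properties using (T-≡; ⇔→≡; if-cong; if-float)
open import Data.Fin using (Fin; zero; suc; splitAt; join; combine; _↑ˡ_; _↑ʳ_; _≟_)
open import Data.Fin.Permutation using (Permutation)
open import Data.Fin.Properties
  using (suc-injective; splitAt-↑ˡ; splitAt-↑ʳ; remQuot-combine; splitAt-join; join-splitAt; +↔⊎)
open import Data.Maybe using (Maybe; just; nothing; maybe)
import Data.Maybe.Properties as Maybe
open import Data.Nat.Properties using (+-0-commutativeMonoid; m+n≡0⇒m≡0; m+n≡0⇒n≡0)
  renaming (suc-injective to suc-injectiveℕ)
import Data.Nat as ℕ
open import Data.Product using (_,_; proj₁; proj₂; uncurry)
import Data.Product.Properties as Product
open import Data.Sum using (_⊎_; inj₁; inj₂; isInj₁)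
open import Data.Unit using (tt)
open import Data.Vec.Functional using (Vector; concat; transpose)
open import Function using (_∘_; const; _↔_; mk↔ₛ′; flip; _⇔_; mk⇔; Equivalence)
open import Function.Bundles using (module Inverse)
open import Function.Construct.Composition using (_↔-∘_)
open import Function.Construct.Symmetry using (↔-sym)
open import Relation.Binary using (DecidableEquality; IsStrictPartialOrder)
open import Relation.Binary.PropositionalEquality as ≡ using (_≡_)
import Relation.Binary.Construct.Add.Supremum.Equality as SupremumEquality
open import Relation.Nullary using (Dec; yes; no; does; contradiction; _×-dec_)
open import Relation.Nullary.Decidable using (dec-true; dec-false)
open import Relation.Nullary.Construct.Add.Supremum using (_⁺)

-- A permutation avoiding the forbidden mappings is a bijection α from V₁ᵋ to
-- V₂ᵋ. Its action on the nodes determines the node operations, and in a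
-- restricted path these force the edge operations: an edge is substituted
-- exactly when its image is an edge, since otherwise it would be removed and
-- then reinserted. For the costs, each summand of the objective is split into
-- a part charged to the first graph (substitution or removal) and an
-- insertion part; the latter is reindexed along α, after which the dummy
-- elements contribute nothing to either part.

-- Finite sums in a commutative monoid.

module SumProperties {a ℓ} (M : CommutativeMonoid a ℓ) where
  open CommutativeMonoid M
  open Sums M
  open import Relation.Binary.Reasoning.Setoid setoid

  sum-zero : ∀ {n} {f : Vector Carrier n} → (∀ i → f i ≈ ε) → sum f ≈ ε
  sum-zero {n} f≈ε = trans (sum-cong-≋ f≈ε) (sum-replicate-zero n)

  sum-single : ∀ {n} {f : Vector Carrier n} k → (∀ i → i ≢ k → f i ≈ ε) → sum f ≈ f k
  sum-single {f = f} zero f≈ε =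
    trans (∙-congˡ (sum-zero λ i → f≈ε (suc i) λ ())) (identityʳ _)
  sum-single {f = f} (suc k) f≈ε =
    trans (∙-cong (f≈ε zero λ ()) (sum-single k λ i i≢k → f≈ε (suc i) (i≢k ∘ suc-injective)))
          (identityˡ _)

  sum-join : ∀ m {n} (f : Vector Carrier (m + n)) →
    sum f ≈ sum (f ∘ (_↑ˡ n)) ∙ sum (f ∘ (m ↑ʳ_))
  sum-join ℕ.zero    f = sym (identityˡ _)
  sum-join (ℕ.suc m) f = trans (∙-congˡ (sum-join m (f ∘ suc))) (sym (assoc _ _ _))

  -- Applied below with `inj₂` marking the dummy elements, whose contribution is thereby discarded.
  sum-inj₁ : ∀ m {n} (f : Fin m ⊎ Fin n → Carrier) → (∀ k → f (inj₂ k) ≈ ε) →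
    sum (f ∘ splitAt m) ≈ sum (f ∘ inj₁)
  sum-inj₁ m {n} f f≈ε = begin
    sum (f ∘ splitAt m)
      ≈⟨ sum-join m _ ⟩
    sum (f ∘ splitAt m ∘ (_↑ˡ n)) ∙ sum (f ∘ splitAt m ∘ (m ↑ʳ_))
      ≡⟨ ≡.cong₂ _∙_ (sum-cong-≗ λ i → ≡.cong f (splitAt-↑ˡ m i n))
                     (sum-cong-≗ λ k → ≡.cong f (splitAt-↑ʳ m n k)) ⟩
    sum (f ∘ inj₁) ∙ sum (f ∘ inj₂)
      ≈⟨ ∙-congˡ (sum-zero f≈ε) ⟩
    sum (f ∘ inj₁) ∙ ε
      ≈⟨ identityʳ _ ⟩
    sum (f ∘ inj₁) ∎

  sum-combine : ∀ m {n} (f : Vector Carrier (m ℕ.* n)) →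
    sum f ≈ sum λ i → sum λ j → f (combine {m} i j)
  sum-combine ℕ.zero        f = refl
  sum-combine (ℕ.suc m) {n} f = trans (sum-join n f) (∙-congˡ (sum-combine m _))

  -- Conjugating `α` with the splitting of the index ranges gives a permutation `π` of indices,
  -- along which `sum-permute` applies. The summand takes an element and its image as two arguments,
  -- so that either one can serve as the summation variable.
  sum-reindex : ∀ {m n r s} (α : (Fin m ⊎ Fin n) ↔ (Fin r ⊎ Fin s))
    (f : Fin m ⊎ Fin n → Fin r ⊎ Fin s → Carrier) →
    let open Inverse α in
    (sum λ i → f (splitAt m i) (to (splitAt m i))) ≈
    (sum λ k → f (from (splitAt r k)) (splitAt r k))
  sum-reindex {m} {n} {r} {s} α f = sym (trans
    (sum-permute g π)
    (reflexive (sum-cong-≗ λ i → ≡.trans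
      (≡.cong (λ y → f (from y) y) (splitAt-join r s (to (splitAt m i))))
      (≡.cong (λ x → f x (to (splitAt m i))) (strictlyInverseʳ (splitAt m i))))))
    where
    open Inverse α
    π : Permutation (m + n) (r + s)
    π = ↔-sym +↔⊎ ↔-∘ (α ↔-∘ +↔⊎)
    g : Vector Carrier (r + s)
    g k = f (from (splitAt r k)) (splitAt r k)

-- Entries of flattened matrices, vectors of sum one, and Boolean tests.

concat-combine : ∀ {a} {A : Set a} {m n} (V : Vector (Vector A n) m) i k →
  concat V (combine i k) ≡ V i k
concat-combine V i k = ≡.cong (uncurry V) (remQuot-combine i k)

module _ where
  open RawMonoidDefinitions ℕ.+-0-rawMonoid using (sum)

  sum≡0 : ∀ {n} (v : Vector ℕ n) → sum v ≡ 0 → ∀ i → v i ≡ 0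
  sum≡0 v eq zero    = m+n≡0⇒m≡0 (v zero) eq
  sum≡0 v eq (suc i) = sum≡0 (v ∘ suc) (m+n≡0⇒n≡0 (v zero) eq) i

  -- Natural summands cannot cancel: a leading 0 is skipped, a leading 1 forces all later entries to
  -- vanish, and a larger entry would already exceed the sum.
  sum≡1 : ∀ {n} (v : Vector ℕ n) → sum v ≡ 1 →
    ∃[ k ] (v k ≡ 1 × (∀ i → i ≢ k → v i ≡ 0))
  sum≡1 {ℕ.suc n} v eq with v zero in v₀
  ... | 0 with k , vₖ , v≡0 ← sum≡1 (v ∘ suc) eq =
    suc k , vₖ , λ where
      zero    _   → v₀
      (suc i) i≢k → v≡0 i (i≢k ∘ ≡.cong suc)
  ... | 1 = zero , v₀ , λ where
      zero    i≢0 → contradiction ≡.refl i≢0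
      (suc i) _   → sum≡0 (v ∘ suc) (suc-injectiveℕ eq) i

does⇒ : ∀ {a} {A : Set a} (A? : Dec A) → T (does A?) → A
does⇒ (yes a) _ = a

⇒does : ∀ {a} {A : Set a} (A? : Dec A) → A → T (does A?)
⇒does (yes _) _ = tt
⇒does (no ¬a) a = contradiction a ¬a

-- Membership in an edit path is a Boolean, so two paths with logically equivalent membership are
-- compared through equality of their tests.
does≡ : ∀ {a} {A : Set a} {b} (A? : Dec A) → T b ⇔ A → does A? ≡ b
does≡ A? b⇔A = ⇔→≡ (mk⇔
  (λ eq → f (⇒ (does⇒ A? (g eq))))
  (λ eq → f (⇒does A? (⇐ (g eq)))))
  where
  open Equivalence b⇔A renaming (to to ⇐; from to ⇒)
  f : ∀ {b} → T b → b ≡ true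
  f = Equivalence.to T-≡
  g : ∀ {b} → b ≡ true → T b
  g = Equivalence.from T-≡

-- Completing a partial matching to a bijection.

module _ {A B : Set} (image : A → Maybe B) (preimage : B → Maybe A)
         (image⇒preimage : ∀ {a b} → image a ≡ just b → preimage b ≡ just a)
         (preimage⇒image : ∀ {a b} → preimage b ≡ just a → image a ≡ just b) where

  -- Unmatched elements go to their own dummies, and the dummies of matched
  -- pairs to each other.
  completion : (A ⊎ B) ↔ (B ⊎ A)
  completion = mk↔ₛ′ to from to∘from from∘to
    where
    to : A ⊎ B → B ⊎ A
    to (inj₁ a) = maybe inj₁ (inj₂ a) (image a)
    to (inj₂ b) = maybe inj₂ (inj₁ b) (preimage b)
    from : B ⊎ A → A ⊎ B
    from (inj₁ b) = maybe inj₁ (inj₂ b) (preimage b)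
    from (inj₂ a) = maybe inj₂ (inj₁ a) (image a)
    to∘from : ∀ y → to (from y) ≡ y
    to∘from (inj₁ b) with preimage b in eq
    ... | just a  rewrite preimage⇒image eq = ≡.refl
    ... | nothing rewrite eq = ≡.refl
    to∘from (inj₂ a) with image a in eq
    ... | just b  rewrite image⇒preimage eq = ≡.refl
    ... | nothing rewrite eq = ≡.refl
    from∘to : ∀ x → from (to x) ≡ x
    from∘to (inj₁ a) with image a in eq
    ... | just b  rewrite image⇒preimage eq = ≡.refl
    ... | nothing rewrite eq = ≡.refl
    from∘to (inj₂ b) with preimage b in eq
    ... | just a  rewrite preimage⇒image eq = ≡.refl
    ... | nothing rewrite eq = ≡.refl

isInj₁-just : ∀ {A B : Set} {x : A ⊎ B} {a} → isInj₁ x ≡ just a → x ≡ inj₁ a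
isInj₁-just {x = inj₁ _} ≡.refl = ≡.refl

-- Arithmetic of finite and infinite costs.

module _ {c ℓ₁ ℓ₂ ℓ₃} (F : OrderedField c ℓ₁ ℓ₂ ℓ₃) where
  open OrderedField F hiding (zero) renaming (_+_ to _⊕_)
  open Extended F
  open SupremumEquality _≈_ using ([_]; ⊤⁺≈⊤⁺; ≈⁺-isEquivalence)
  private module < = IsStrictPartialOrder isStrictPartialOrder

  ½*[x⊕x]≈x : ∀ x → ½ * (x ⊕ x) ≈ x
  ½*[x⊕x]≈x x = begin
    ½ * (x ⊕ x)              ≈⟨ *-congˡ (+-cong (sym (*-identityˡ x)) (sym (*-identityˡ x))) ⟩
    ½ * (1# * x ⊕ 1# * x)    ≈⟨ *-congˡ (sym (distribʳ x 1# 1#)) ⟩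
    ½ * ((1# ⊕ 1#) * x)      ≈⟨ *-assoc _ _ _ ⟨
    ½ * (1# ⊕ 1#) * x        ≈⟨ *-congʳ (*-congˡ 2≈2-0) ⟩
    ½ * (1# ⊕ 1# - 0#) * x   ≈⟨ *-congʳ ½-inverse ⟩
    1# * x                   ≈⟨ *-identityˡ x ⟩
    x                        ∎
    where
    open import Relation.Binary.Reasoning.Setoid (CommutativeRing.setoid commutativeRing)
    open import Algebra.Properties.Ring (CommutativeRing.ring commutativeRing) using (-0#≈0#)
    -- An apartness `x # y` yields an inverse of the difference `x - y`, so `½` is by definition an
    -- inverse of `1# ⊕ 1# - 0#`.
    2≈2-0 : 1# ⊕ 1# ≈ 1# ⊕ 1# - 0#
    2≈2-0 = sym (trans (+-congˡ -0#≈0#) (+-identityʳ _))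
    -- The proof of 0 < 2 is the one in the definition of ½.
    ½-inverse : ½ * (1# ⊕ 1# - 0#) ≈ 1#
    ½-inverse = proj₁ (proj₂ (#⇒invertible (Equivalence.from #⇔<⊎> (inj₂
      (<.trans 0<1 (<.<-respˡ-≈ (+-identityʳ 1#) (+-monoʳ-< 1# 0<1)))))))

  +⁺-commutativeMonoid : CommutativeMonoid _ _
  +⁺-commutativeMonoid = record
    { _≈_ = _≈⁺_
    ; _∙_ = _+⁺_
    ; ε   = [ 0# ]
    ; isCommutativeMonoid = record
      { isMonoid = record
        { isSemigroup = record
          { isMagma = record
            { isEquivalence = ≈⁺-isEquivalence isEquivalence
            ; ∙-cong = λ where
                [ p ] [ q ] → [ +-cong p q ]
                [ _ ] ⊤⁺≈⊤⁺ → ⊤⁺≈⊤⁺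
                ⊤⁺≈⊤⁺ _     → ⊤⁺≈⊤⁺
            }
          ; assoc = λ where
              [ x ] [ y ] [ z ] → [ +-assoc x y z ]
              [ x ] [ y ] ⊤⁺    → ⊤⁺≈⊤⁺
              [ x ] ⊤⁺    z     → ⊤⁺≈⊤⁺
              ⊤⁺    y     z     → ⊤⁺≈⊤⁺
          }
        ; identity = (λ where
            [ x ] → [ +-identityˡ x ]
            ⊤⁺    → ⊤⁺≈⊤⁺) , λ where
            [ x ] → [ +-identityʳ x ]
            ⊤⁺    → ⊤⁺≈⊤⁺
        }
      ; comm = λ where
          [ x ] [ y ] → [ +-comm x y ]
          [ x ] ⊤⁺    → ⊤⁺≈⊤⁺
          ⊤⁺    [ y ] → ⊤⁺≈⊤⁺
          ⊤⁺    ⊤⁺    → ⊤⁺≈⊤⁺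
      }
    }

  private
    module + = Sums (CommutativeRing.+-commutativeMonoid commutativeRing)
    module +⁺ = CommutativeMonoid +⁺-commutativeMonoid
    module Σ⁺ where
      open Sums +⁺-commutativeMonoid public
      open SumProperties +⁺-commutativeMonoid public

  half-cong : ∀ {x y} → x ≈⁺ y → half x ≈⁺ half y
  half-cong [ p ]   = [ *-congˡ p ]
  half-cong ⊤⁺≈⊤⁺ = ⊤⁺≈⊤⁺

  ≈⁺⊤⁺⇒≡ : ∀ {x} → x ≈⁺ ⊤⁺ → x ≡ ⊤⁺
  ≈⁺⊤⁺⇒≡ ⊤⁺≈⊤⁺ = ≡.refl

  +⁺-⊤⁺ʳ : ∀ x {y} → y ≡ ⊤⁺ → x +⁺ y ≡ ⊤⁺
  +⁺-⊤⁺ʳ [ x ] ≡.refl = ≡.refl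
  +⁺-⊤⁺ʳ ⊤⁺    _      = ≡.refl

  -- `⊤⁺` is absorbing and no negative infinity exists, so a single infinite term decides the sum.
  sum⁺-⊤⁺ : ∀ {r} (v : Vector (Carrier ⁺) r) i → v i ≡ ⊤⁺ → sum⁺ v ≡ ⊤⁺
  sum⁺-⊤⁺ v zero    eq rewrite eq = ≡.refl
  sum⁺-⊤⁺ v (suc i) eq = +⁺-⊤⁺ʳ (v zero) (sum⁺-⊤⁺ (v ∘ suc) i eq)

  sum⁺-finite : ∀ {r} {v : Vector (Carrier ⁺) r} {u} → (∀ i → v i ≡ [ u i ]) →
    sum⁺ v ≡ [ +.sum u ]
  sum⁺-finite {ℕ.zero}  eq = ≡.refl
  sum⁺-finite {ℕ.suc r} eq = ≡.cong₂ _+⁺_ (eq zero) (sum⁺-finite (eq ∘ suc))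

  -- After splitting the sum by rows, each row has one coefficient 1, at `σ i`. The other
  -- coefficients are 0 and remove even infinite entries, by the convention that `0 · ⊤⁺` is
  -- `[ 0# ]`.
  dot-permutation : ∀ {r s} {X : Matrix ℕ r s} {σ : Fin r → Fin s} →
    (∀ i → X i (σ i) ≡ 1 × (∀ k → k ≢ σ i → X i k ≡ 0)) →
    ∀ v → dot (concat X) v ≈⁺ sum⁺ λ i → v (combine i (σ i))
  dot-permutation {r} {s} {X} {σ} X-σ v = +⁺.trans
    (Σ⁺.sum-combine r _)
    (Σ⁺.sum-cong-≋ λ i → +⁺.trans
      (Σ⁺.sum-single (σ i) λ k k≢ → +⁺.reflexive (≡.cong (_· v (combine i k))
        (≡.trans (concat-combine X i k) (proj₂ (X-σ i) k k≢))))
      (+⁺.trans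
        (+⁺.reflexive (≡.cong (_· v (combine i (σ i)))
          (≡.trans (concat-combine X i (σ i)) (proj₁ (X-σ i)))))
        (+⁺.identityʳ _)))

module EditPaths {c ℓ₁ ℓ₂ ℓ₃} (F : OrderedField c ℓ₁ ℓ₂ ℓ₃)
                 {n m q} (G₁ : Graph n q) (G₂ : Graph m q)
                 (𝒞 : Costs F G₁ G₂) where
  open OrderedField F hiding (zero) renaming (_+_ to _⊕_)
  open EditDistance F G₁ G₂ 𝒞
  open Costs 𝒞
  open CommutativeRing commutativeRing using (+-commutativeMonoid)
  open Sums +-commutativeMonoid
  open SumProperties +-commutativeMonoid
  open SupremumEquality _≈_ using ([_])
  private
    module G₁ = Graph G₁
    module G₂ = Graph G₂
    module ℕΣ = SumProperties +-0-commutativeMonoid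
    module +⁺ = CommutativeMonoid (+⁺-commutativeMonoid F)
    module Σ⁺ = Sums (+⁺-commutativeMonoid F)

  -- Edges between elements of the augmented sets.

  edge₁-just : ∀ {x y i j} → edge₁ x y ≡ just (i , j) →
    x ≡ inj₁ i × y ≡ inj₁ j × G₁.Edge (i , j)
  edge₁-just {inj₁ i} {inj₁ j} eq with G₁.isEdge (i , j) in e
  edge₁-just {inj₁ i} {inj₁ j} ≡.refl | true = ≡.refl , ≡.refl , Equivalence.from T-≡ e

  edge₂-just : ∀ {x y k l} → edge₂ x y ≡ just (k , l) →
    x ≡ inj₁ k × y ≡ inj₁ l × G₂.Edge (k , l)
  edge₂-just {inj₁ k} {inj₁ l} eq with G₂.isEdge (k , l) in e
  edge₂-just {inj₁ k} {inj₁ l} ≡.refl | true = ≡.refl , ≡.refl , Equivalence.from T-≡ e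

  edge₁-edge : ∀ {i j} → G₁.Edge (i , j) → edge₁ (inj₁ i) (inj₁ j) ≡ just (i , j)
  edge₁-edge e = if-cong (Equivalence.to T-≡ e)

  edge₂-edge : ∀ {k l} → G₂.Edge (k , l) → edge₂ (inj₁ k) (inj₁ l) ≡ just (k , l)
  edge₂-edge e = if-cong (Equivalence.to T-≡ e)

  -- The restricted edit path of a bijection.

  module Path (α : V₁ᵋ ↔ V₂ᵋ) where
    open Inverse α

    nodeImage : Fin n → Maybe (Fin m)
    nodeImage i = isInj₁ (to (inj₁ i))

    nodePreimage : Fin m → Maybe (Fin n)
    nodePreimage k = isInj₁ (from (inj₁ k))

    -- `edge₂` returns `nothing` both when an endpoint goes to a dummy and when the image couple is
    -- not an edge: these are exactly the cases in which an edge is removed.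
    edgeImage : Couple n → Maybe (Couple m)
    edgeImage (i , j) = edge₂ (to (inj₁ i)) (to (inj₁ j))

    edgePreimage : Couple m → Maybe (Couple n)
    edgePreimage (k , l) = edge₁ (from (inj₁ k)) (from (inj₁ l))

    -- Substitutions and removals are read off images, insertions off preimages. Being an edge of
    -- `G₁` is required separately for the source of an edge operation, because `edgeImage` inspects
    -- only the images of the endpoints; that a substituted edge lands on an edge of `G₂` is built
    -- into `edge₂`.
    InPath : Operation n m → Set
    InPath (substituteNode i k) = nodeImage i ≡ just k
    InPath (removeNode i)       = nodeImage i ≡ nothing
    InPath (insertNode k)       = nodePreimage k ≡ nothing
    InPath (substituteEdge e f) = G₁.Edge e × edgeImage e ≡ just f
    InPath (removeEdge e)       = G₁.Edge e × edgeImage e ≡ nothing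
    InPath (insertEdge f)       = G₂.Edge f × edgePreimage f ≡ nothing

    _≟ᵛ_ : ∀ {r} → DecidableEquality (Maybe (Fin r))
    _≟ᵛ_ = Maybe.≡-dec _≟_

    _≟ᵉ_ : ∀ {r} → DecidableEquality (Maybe (Couple r))
    _≟ᵉ_ = Maybe.≡-dec (Product.≡-dec _≟_ _≟_)

    inPath? : ∀ o → Dec (InPath o)
    inPath? (substituteNode i k) = nodeImage i ≟ᵛ just k
    inPath? (removeNode i)       = nodeImage i ≟ᵛ nothing
    inPath? (insertNode k)       = nodePreimage k ≟ᵛ nothing
    inPath? (substituteEdge e f) = T? (G₁.isEdge e) ×-dec (edgeImage e ≟ᵉ just f)
    inPath? (removeEdge e)       = T? (G₁.isEdge e) ×-dec (edgeImage e ≟ᵉ nothing)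
    inPath? (insertEdge f)       = T? (G₂.isEdge f) ×-dec (edgePreimage f ≟ᵉ nothing)

    to-inj₁ : ∀ {i k} → nodeImage i ≡ just k → to (inj₁ i) ≡ inj₁ k
    to-inj₁ = isInj₁-just

    from-inj₁ : ∀ {i k} → nodePreimage k ≡ just i → from (inj₁ k) ≡ inj₁ i
    from-inj₁ = isInj₁-just

    nodePreimage-image : ∀ {i k} → nodeImage i ≡ just k → nodePreimage k ≡ just i
    nodePreimage-image {i} eq = ≡.cong isInj₁ (inverseʳ (≡.sym (to-inj₁ eq)))

    nodeImage-preimage : ∀ {i k} → nodePreimage k ≡ just i → nodeImage i ≡ just k
    nodeImage-preimage eq = ≡.cong isInj₁ (inverseˡ (≡.sym (from-inj₁ eq)))

    edgeImage-just : ∀ {i j k l} → edgeImage (i , j) ≡ just (k , l) →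
      nodeImage i ≡ just k × nodeImage j ≡ just l × G₂.Edge (k , l)
    edgeImage-just eq with p , q , f ← edge₂-just eq = ≡.cong isInj₁ p , ≡.cong isInj₁ q , f

    edgePreimage-just : ∀ {i j k l} → edgePreimage (k , l) ≡ just (i , j) →
      nodePreimage k ≡ just i × nodePreimage l ≡ just j × G₁.Edge (i , j)
    edgePreimage-just eq with p , q , e ← edge₁-just eq = ≡.cong isInj₁ p , ≡.cong isInj₁ q , e

    edgeImage-edge : ∀ {i j k l} → nodeImage i ≡ just k → nodeImage j ≡ just l →
      G₂.Edge (k , l) → edgeImage (i , j) ≡ just (k , l)
    edgeImage-edge p q f = ≡.trans (≡.cong₂ edge₂ (to-inj₁ p) (to-inj₁ q)) (edge₂-edge f)

    edgePreimage-edge : ∀ {i j k l} → nodePreimage k ≡ just i → nodePreimage l ≡ just j →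
      G₁.Edge (i , j) → edgePreimage (k , l) ≡ just (i , j)
    edgePreimage-edge p q e = ≡.trans (≡.cong₂ edge₁ (from-inj₁ p) (from-inj₁ q)) (edge₁-edge e)

    -- The endpoint maps are mutually inverse where defined, and `edgePreimage` additionally tests
    -- for an edge of `G₁`, which the first hypothesis supplies. With the lemma that follows, this
    -- makes edge substitution a partial matching.
    edgePreimage-image : ∀ {e f} → G₁.Edge e → edgeImage e ≡ just f → edgePreimage f ≡ just e
    edgePreimage-image e eq with p , q , _ ← edgeImage-just eq =
      edgePreimage-edge (nodePreimage-image p) (nodePreimage-image q) e

    edgeImage-preimage : ∀ {e f} → G₂.Edge f → edgePreimage f ≡ just e → edgeImage e ≡ just f
    edgeImage-preimage f eq with p , q , _ ← edgePreimage-just eq =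
      edgeImage-edge (nodeImage-preimage p) (nodeImage-preimage q) f

    inPath-source : ∀ o {x} → InPath o → source o ≡ just x → G₁ ∋ x
    inPath-source (substituteNode i k) _       ≡.refl = tt
    inPath-source (removeNode i)       _       ≡.refl = tt
    inPath-source (substituteEdge e f) (e∈ , _) ≡.refl = e∈
    inPath-source (removeEdge e)       (e∈ , _) ≡.refl = e∈

    inPath-target : ∀ o {y} → InPath o → target o ≡ just y → G₂ ∋ y
    inPath-target (substituteNode i k) _       ≡.refl = tt
    inPath-target (insertNode k)       _       ≡.refl = tt
    inPath-target (substituteEdge e f) (_ , p) ≡.refl = proj₂ (proj₂ (edgeImage-just p))
    inPath-target (insertEdge f)       (f∈ , _) ≡.refl = f∈

    -- The witness for `sources-once`: the image of an element dictates the only operation that can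
    -- involve it.
    operationFrom : Element n → Operation n m
    operationFrom (node i)   = maybe (substituteNode i) (removeNode i) (nodeImage i)
    operationFrom (couple e) = maybe (substituteEdge e) (removeEdge e) (edgeImage e)

    operationTo : Element m → Operation n m
    operationTo (node k)   = maybe (λ i → substituteNode i k) (insertNode k) (nodePreimage k)
    operationTo (couple f) = maybe (λ e → substituteEdge e f) (insertEdge f) (edgePreimage f)

    operationFrom-inPath : ∀ x → G₁ ∋ x →
      InPath (operationFrom x) × source (operationFrom x) ≡ just x
    operationFrom-inPath (node i) _ with nodeImage i in eq
    ... | just _  = eq , ≡.refl
    ... | nothing = eq , ≡.refl
    operationFrom-inPath (couple e) e∈ with edgeImage e in eq
    ... | just _  = (e∈ , eq) , ≡.refl
    ... | nothing = (e∈ , eq) , ≡.refl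

    operationTo-inPath : ∀ y → G₂ ∋ y →
      InPath (operationTo y) × target (operationTo y) ≡ just y
    operationTo-inPath (node k) _ with nodePreimage k in eq
    ... | just _  = nodeImage-preimage eq , ≡.refl
    ... | nothing = eq , ≡.refl
    operationTo-inPath (couple f) f∈ with edgePreimage f in eq
    ... | just _  = (proj₂ (proj₂ (edgePreimage-just eq)) , edgeImage-preimage f∈ eq) , ≡.refl
    ... | nothing = (f∈ , eq) , ≡.refl

    operationFrom-unique : ∀ o {x} → InPath o → source o ≡ just x → operationFrom x ≡ o
    operationFrom-unique (substituteNode i k) p       ≡.refl = ≡.cong (maybe _ _) p
    operationFrom-unique (removeNode i)       p       ≡.refl = ≡.cong (maybe _ _) p
    operationFrom-unique (substituteEdge e f) (_ , p) ≡.refl = ≡.cong (maybe _ _) p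
    operationFrom-unique (removeEdge e)       (_ , p) ≡.refl = ≡.cong (maybe _ _) p

    -- Membership of a substitution is recorded through the image, whereas `operationTo` reads the
    -- preimage; the inverse laws translate between the two.
    operationTo-unique : ∀ o {y} → InPath o → target o ≡ just y → operationTo y ≡ o
    operationTo-unique (substituteNode i k) p        ≡.refl =
      ≡.cong (maybe _ _) (nodePreimage-image p)
    operationTo-unique (insertNode k)       p        ≡.refl = ≡.cong (maybe _ _) p
    operationTo-unique (substituteEdge e f) (e∈ , p) ≡.refl =
      ≡.cong (maybe _ _) (edgePreimage-image e∈ p)
    operationTo-unique (insertEdge f)       (_ , p)  ≡.refl = ≡.cong (maybe _ _) p

    path : RestrictedEditPath G₁ G₂
    path = record
      { member        = λ o → does (inPath? o)
      ; sources-valid = λ {o} o∈ → inPath-source o (does⇒ (inPath? o) o∈)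
      ; targets-valid = λ {o} o∈ → inPath-target o (does⇒ (inPath? o) o∈)
      ; sources-once  = λ x x∈ → let p , s = operationFrom-inPath x x∈ in
          operationFrom x , (⇒does (inPath? _) p , s) ,
          λ {o} (o∈ , s) → operationFrom-unique o (does⇒ (inPath? o) o∈) s
      ; targets-once  = λ y y∈ → let p , t = operationTo-inPath y y∈ in
          operationTo y , (⇒does (inPath? _) p , t) ,
          λ {o} (o∈ , t) → operationTo-unique o (does⇒ (inPath? o) o∈) t
      ; endpoints     = λ {i} {j} {k} {l} o∈ →
          let _ , p = does⇒ (inPath? (substituteEdge (i , j) (k , l))) o∈
              q , r , _ = edgeImage-just p
          in ⇒does (inPath? (substituteNode i k)) q , ⇒does (inPath? (substituteNode j l)) r
      -- Substituted endpoints together with the edge `(k , l)` make `edgeImage (i , j)` equal to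
      -- `just (k , l)`, which contradicts the removal of `(i , j)`.
      ; no-reinsert   = λ {i} {j} {k} {l} ik∈ jl∈ ij∈ f∈ _ →
          let p = does⇒ (inPath? (substituteNode i k)) ik∈
              q = does⇒ (inPath? (substituteNode j l)) jl∈
              _ , r = does⇒ (inPath? (removeEdge (i , j))) ij∈
          in contradiction (≡.trans (≡.sym r) (edgeImage-edge p q f∈)) λ ()
      }

  -- Sums over couples and the splitting of costs.

  if-½-cong : ∀ b {x y} → x ≈ y → (if b then ½ * x else x) ≈ (if b then ½ * y else y)
  if-½-cong true  x≈y = *-congˡ x≈y
  if-½-cong false x≈y = x≈y

  sumCouples-cong : ∀ {r} {f g : Couple r → Carrier} → (∀ e → f e ≈ g e) →
    sumCouples f ≈ sumCouples g
  sumCouples-cong f≈g = sum-cong-≋ λ i → sum-cong-≋ λ j → f≈g (i , j)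

  sumCouples-zero : ∀ {r} {f : Couple r → Carrier} → (∀ e → f e ≈ 0#) → sumCouples f ≈ 0#
  sumCouples-zero f≈0 = sum-zero λ i → sum-zero λ j → f≈0 (i , j)

  sumCouples-single : ∀ {r} {f : Couple r → Carrier} e → (∀ e′ → e′ ≢ e → f e′ ≈ 0#) →
    sumCouples f ≈ f e
  sumCouples-single (i , j) f≈0 = trans
    (sum-single i λ i′ i′≢i → sum-zero λ j′ → f≈0 (i′ , j′) (i′≢i ∘ ≡.cong proj₁))
    (sum-single j λ j′ j′≢j → f≈0 (i , j′) (j′≢j ∘ ≡.cong proj₂))

  sumCouples-distrib-+ : ∀ {r} (f g : Couple r → Carrier) →
    sumCouples (λ e → f e ⊕ g e) ≈ sumCouples f ⊕ sumCouples g
  sumCouples-distrib-+ f g = trans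
    (sum-cong-≋ λ i → ∑-distrib-+ (λ j → f (i , j)) (λ j → g (i , j)))
    (∑-distrib-+ (λ i → sum λ j → f (i , j)) (λ i → sum λ j → g (i , j)))

  -- Shared by nodes and edges: `nothing` stands for a dummy element, or for a couple that is not an
  -- edge.
  sourceCost : {A B : Set} → (A → B → Carrier) → (A → Carrier) → Maybe A → Maybe B → Carrier
  sourceCost substitution removal a b = maybe (λ x → maybe (substitution x) (removal x) b) 0# a

  insertionCost : {A B : Set} → (B → Carrier) → Maybe A → Maybe B → Carrier
  insertionCost insertion a b = maybe (λ y → maybe (const 0#) (insertion y) a) 0# b

  allowedNodeCost-split : ∀ x y → allowedNodeCost x y ≈
    sourceCost cvs cvd (isInj₁ x) (isInj₁ y) ⊕ insertionCost cvi (isInj₁ x) (isInj₁ y)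
  allowedNodeCost-split (inj₁ _) (inj₁ _) = sym (+-identityʳ _)
  allowedNodeCost-split (inj₁ _) (inj₂ _) = sym (+-identityʳ _)
  allowedNodeCost-split (inj₂ _) (inj₁ _) = sym (+-identityˡ _)
  allowedNodeCost-split (inj₂ _) (inj₂ _) = sym (+-identityˡ _)

  allowedEdgeCost-split : ∀ e f → allowedEdgeCost e f ≈
    sourceCost ces ced e f ⊕ insertionCost cei e f
  allowedEdgeCost-split (just _) (just _) = sym (+-identityʳ _)
  allowedEdgeCost-split (just _) nothing  = sym (+-identityʳ _)
  allowedEdgeCost-split nothing  (just _) = sym (+-identityˡ _)
  allowedEdgeCost-split nothing  nothing  = sym (+-identityˡ _)

  module _ {B : Set} (_≟ᴮ_ : DecidableEquality B) where
    private
      _≟ᴹ_ : DecidableEquality (Maybe B)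
      _≟ᴹ_ = Maybe.≡-dec _≟ᴮ_

    -- At most one `y` satisfies the test against `just y`, so the substitution terms collapse to
    -- one, and the removal term survives exactly when there is none. The operator `S` is `sum` for
    -- nodes and `sumCouples` for edges; `b` is `true` for nodes and the edge test for couples.
    sum-maybe : (S : (B → Carrier) → Carrier) →
      (∀ {f} → (∀ y → f y ≈ 0#) → S f ≈ 0#) →
      (∀ {f} x → (∀ y → y ≢ x → f y ≈ 0#) → S f ≈ f x) →
      ∀ b t g r →
      S (λ y → if b ∧ does (t ≟ᴹ just y) then g y else 0#) ⊕
      (if b ∧ does (t ≟ᴹ nothing) then r else 0#) ≈
      (if b then maybe g r t else 0#)
    sum-maybe S S-zero S-single false t g r =
      trans (+-identityʳ _) (S-zero λ _ → refl)
    sum-maybe S S-zero S-single true nothing g r =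
      trans (+-congʳ (S-zero λ _ → refl)) (+-identityˡ r)
    sum-maybe S S-zero S-single true (just x) g r = trans (+-identityʳ _) (trans
      (S-single x λ y y≢x → reflexive (if-cong (dec-false (x ≟ᴮ y) (y≢x ∘ ≡.sym))))
      (reflexive (if-cong (dec-true (x ≟ᴮ x) ≡.refl))))

    if-nothing : ∀ b t (r : Carrier) →
      (if b ∧ does (t ≟ᴹ nothing) then r else 0#) ≡ (if b then maybe (const 0#) r t else 0#)
    if-nothing false t        r = ≡.refl
    if-nothing true  (just _) r = ≡.refl
    if-nothing true  nothing  r = ≡.refl

  -- The cost of the path of a bijection.

  module _ (α : V₁ᵋ ↔ V₂ᵋ) where
    open Inverse α
    open Path α
    open import Relation.Binary.Reasoning.Setoid setoid

    nodeSources nodeInsertions edgeSources edgeInsertions : Carrier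
    nodeSources    = sum λ i → sourceCost cvs cvd (just i) (nodeImage i)
    nodeInsertions = sum λ k → insertionCost cvi (nodePreimage k) (just k)
    edgeSources    = sumCouples λ (i , j) →
      sourceCost ces ced (edge₁ (inj₁ i) (inj₁ j)) (edgeImage (i , j))
    edgeInsertions = sumCouples λ (k , l) →
      insertionCost cei (edgePreimage (k , l)) (edge₂ (inj₁ k) (inj₁ l))

    nodeOperationsCost-path : nodeOperationsCost path ≈ nodeSources ⊕ nodeInsertions
    nodeOperationsCost-path = +-cong
      (trans (sym (∑-distrib-+ (λ i → sum λ k → costInP path (substituteNode i k)) _))
             (sum-cong-≋ λ i → sum-maybe _≟_ sum sum-zero sum-single
               true (nodeImage i) (cvs i) (cvd i)))
      (sum-cong-≋ λ k → reflexive (if-nothing _≟_ true (nodePreimage k) (cvi k)))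

    edgeOperationsCost-path : edgeOperationsCost path ≈ edgeSources ⊕ edgeInsertions
    edgeOperationsCost-path = +-cong
      (trans (sym (sumCouples-distrib-+ (λ e → sumCouples λ f → costInP path (substituteEdge e f)) _))
             (sumCouples-cong λ e → trans
               (sum-maybe (Product.≡-dec _≟_ _≟_) sumCouples sumCouples-zero sumCouples-single
                 (G₁.isEdge e) (edgeImage e) (ces e) (ced e))
               -- `inPath?` tests for an edge outside the cost, `edge₁` inside the argument of
               -- `maybe`; `if-float` moves the test across.
               (reflexive (≡.sym (if-float (maybe _ 0#) (G₁.isEdge e))))))
      (sumCouples-cong λ f → reflexive (≡.trans
        (if-nothing (Product.≡-dec _≟_ _≟_) (G₂.isEdge f) (edgePreimage f) (cei f))
        (≡.sym (if-float (maybe _ 0#) (G₂.isEdge f)))))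

    -- When `α` avoids the forbidden mappings, this is the finite value of the linear term of the
    -- objective, and `edgeSum` is that of the quadratic form of `D`.
    nodeSum : Carrier
    nodeSum = sum λ i → allowedNodeCost (splitAt n i) (to (splitAt n i))

    edgeEntry : Fin (n + m) → Fin (n + m) → Carrier
    edgeEntry i j = allowedEdgeCost
      (edge₁ (splitAt n i) (splitAt n j)) (edge₂ (to (splitAt n i)) (to (splitAt n j)))

    edgeSum : Carrier
    edgeSum = sum λ i → sum λ j → edgeEntry i j

    -- The source part vanishes on the dummies of `V₁ᵋ` as it stands; the insertion part vanishes on
    -- the dummies of `V₂ᵋ`, so it is first reindexed along `α`.
    nodeSum≈ : nodeSum ≈ nodeSources ⊕ nodeInsertions
    nodeSum≈ = begin
      nodeSum
        ≈⟨ sum-cong-≋ (λ i → allowedNodeCost-split (splitAt n i) (to (splitAt n i))) ⟩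
      (sum λ i → s (splitAt n i) (to (splitAt n i)) ⊕ t (splitAt n i) (to (splitAt n i)))
        ≈⟨ ∑-distrib-+ (λ i → s (splitAt n i) (to (splitAt n i))) _ ⟩
      (sum λ i → s (splitAt n i) (to (splitAt n i))) ⊕
      (sum λ i → t (splitAt n i) (to (splitAt n i)))
        ≈⟨ +-cong (sum-inj₁ n (λ x → s x (to x)) λ _ → refl)
                  (trans (sum-reindex α t) (sum-inj₁ m (λ y → t (from y) y) λ _ → refl)) ⟩
      nodeSources ⊕ nodeInsertions ∎
      where
      s t : V₁ᵋ → V₂ᵋ → Carrier
      s x y = sourceCost cvs cvd (isInj₁ x) (isInj₁ y)
      t x y = insertionCost cvi (isInj₁ x) (isInj₁ y)

    edgeSum≈ : edgeSum ≈ edgeSources ⊕ edgeInsertions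
    edgeSum≈ = begin
      edgeSum
        ≈⟨ sum-cong-≋ (λ i → trans
             (sum-cong-≋ λ j → allowedEdgeCost-split
               (edge₁ (splitAt n i) (splitAt n j)) (edge₂ (to (splitAt n i)) (to (splitAt n j))))
             (∑-distrib-+ (λ j → s (splitAt n i) (splitAt n j)) _)) ⟩
      (sum λ i → (sum λ j → s (splitAt n i) (splitAt n j)) ⊕
                 (sum λ j → t (splitAt n i) (to (splitAt n i)) (splitAt n j) (to (splitAt n j))))
        ≈⟨ ∑-distrib-+ (λ i → sum λ j → s (splitAt n i) (splitAt n j)) _ ⟩
      (sum λ i → sum λ j → s (splitAt n i) (splitAt n j)) ⊕
      (sum λ i → sum λ j → t (splitAt n i) (to (splitAt n i)) (splitAt n j) (to (splitAt n j)))
        ≈⟨ +-cong s-sum t-sum ⟩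
      edgeSources ⊕ edgeInsertions ∎
      where
      s : V₁ᵋ → V₁ᵋ → Carrier
      s x x′ = sourceCost ces ced (edge₁ x x′) (edge₂ (to x) (to x′))

      -- Elements and their images are separate arguments here, so that the inner and the outer sum
      -- can be reindexed one after the other.
      t : V₁ᵋ → V₂ᵋ → V₁ᵋ → V₂ᵋ → Carrier
      t x y x′ y′ = insertionCost cei (edge₁ x x′) (edge₂ y y′)

      s-sum : (sum λ i → sum λ j → s (splitAt n i) (splitAt n j)) ≈ edgeSources
      s-sum = trans
        (sum-inj₁ n (λ x → sum λ j → s x (splitAt n j)) λ _ → sum-zero {n + m} λ _ → refl)
        (sum-cong-≋ λ i → sum-inj₁ n (s (inj₁ i)) λ _ → refl)

      t-sum : (sum λ i → sum λ j →
        t (splitAt n i) (to (splitAt n i)) (splitAt n j) (to (splitAt n j))) ≈ edgeInsertions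
      t-sum = begin
        (sum λ i → sum λ j → t (splitAt n i) (to (splitAt n i)) (splitAt n j) (to (splitAt n j)))
          ≈⟨ sum-cong-≋ (λ i → sum-reindex α (t (splitAt n i) (to (splitAt n i)))) ⟩
        (sum λ i → sum λ l → t (splitAt n i) (to (splitAt n i)) (from (splitAt m l)) (splitAt m l))
          ≈⟨ sum-reindex α (λ x y → sum λ l → t x y (from (splitAt m l)) (splitAt m l)) ⟩
        (sum λ k → sum λ l → t (from (splitAt m k)) (splitAt m k) (from (splitAt m l)) (splitAt m l))
          ≈⟨ sum-inj₁ m (λ y → sum λ l → t (from y) y (from (splitAt m l)) (splitAt m l))
               (λ _ → sum-zero {m + n} λ _ → refl) ⟩
        (sum λ k → sum λ l → t (from (inj₁ k)) (inj₁ k) (from (splitAt m l)) (splitAt m l))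
          ≈⟨ sum-cong-≋ (λ k → sum-inj₁ m (λ y → t (from (inj₁ k)) (inj₁ k) (from y) y)
               λ _ → refl) ⟩
        edgeInsertions ∎

    γ-path : γ path ≈ nodeSum ⊕ (if does bothUndirected? then ½ * edgeSum else edgeSum)
    γ-path = +-cong
      (trans nodeOperationsCost-path (sym nodeSum≈))
      (if-½-cong (does bothUndirected?) (trans edgeOperationsCost-path (sym edgeSum≈)))

    -- Permutation matrices and the value of the objective.

    column : Fin (n + m) → Fin (m + n)
    column i = join m n (to (splitAt n i))

    row : Fin (m + n) → Fin (n + m)
    row k = join n m (from (splitAt m k))

    Represents : Matrix ℕ (n + m) (m + n) → Set
    Represents X = ∀ i → X i (column i) ≡ 1 × (∀ k → k ≢ column i → X i k ≡ 0)

    Allowed : Set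
    Allowed = ∀ x → forbidden x (to x) ≡ false

    -- The decision whether both graphs are undirected becomes an argument, so that the two forms of
    -- `Δ` can be treated by matching on it.
    Δ-entry : Bool → Fin (n + m) → Fin (n + m) → Carrier ⁺
    Δ-entry undirected i j = if undirected then D p r else D p r +⁺ D r p
      where
      p = combine i (column i)
      r = combine j (column j)

    -- `dot-permutation` is applied to both factors of the quadratic term, then to the linear term,
    -- leaving only the entries selected by `column`.
    objective-represented : ∀ {X} → Represents X → objective X ≈⁺
      half (sum⁺ λ i → sum⁺ λ j → Δ-entry (does bothUndirected?) i j) +⁺ (sum⁺ λ i → C i (column i))
    objective-represented {X} X-α = +⁺.∙-cong
      (half-cong F (+⁺.trans (dot-permutation F X-α (mulVec Δ (vec X)))
        (Σ⁺.sum-cong-≋ λ i → dot-permutation F X-α (Δ (combine i (column i))))))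
      (+⁺.trans (dot-permutation F X-α (vec C))
        (+⁺.reflexive (Σ⁺.sum-cong-≗ λ i → concat-combine C i (column i))))

    C-column : ∀ i → C i (column i) ≡ nodeCost (splitAt n i) (to (splitAt n i))
    C-column i = ≡.cong (nodeCost (splitAt n i)) (splitAt-join m n (to (splitAt n i)))

    D-column : ∀ i j → D (combine i (column i)) (combine j (column j)) ≡
      edgeCost (splitAt n i) (to (splitAt n i)) (splitAt n j) (to (splitAt n j))
    D-column i j = ≡.trans
      (≡.cong (λ v → v (combine j (column j))) (concat-combine (λ i k → vec (d i k)) i (column i)))
      (≡.trans (concat-combine (d i (column i)) j (column j))
        (≡.cong₂ (λ y y′ → edgeCost (splitAt n i) y (splitAt n j) y′)
          (splitAt-join m n (to (splitAt n i))) (splitAt-join m n (to (splitAt n j)))))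
      where
      d : Fin (n + m) → Fin (m + n) → Matrix (Carrier ⁺) (n + m) (m + n)
      d i k j l = edgeCost (splitAt n i) (splitAt m k) (splitAt n j) (splitAt m l)

    -- A forbidden mapping used by `α` puts `⊤⁺` into the linear term, and this absorbs everything
    -- else.
    finite⇒allowed : ∀ {X} → Represents X → objective X ≢ ⊤⁺ → Allowed
    finite⇒allowed {X} X-α finite x with forbidden x (to x) in eq
    ... | false = ≡.refl
    ... | true  = contradiction (≈⁺⊤⁺⇒≡ F objective≈⊤⁺) finite
      where
      C≡⊤⁺ : C (join n m x) (column (join n m x)) ≡ ⊤⁺
      C≡⊤⁺ = ≡.trans (C-column (join n m x))
        (≡.trans (≡.cong (λ x → nodeCost x (to x)) (splitAt-join n m x)) (if-cong eq))
      objective≈⊤⁺ : objective X ≈⁺ ⊤⁺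
      objective≈⊤⁺ = +⁺.trans (objective-represented X-α) (+⁺.reflexive
        (+⁺-⊤⁺ʳ F _ (sum⁺-⊤⁺ F _ (join n m x) C≡⊤⁺)))

    D-allowed : Allowed → ∀ i j →
      D (combine i (column i)) (combine j (column j)) ≡ [ edgeEntry i j ]
    D-allowed allowed i j = ≡.trans (D-column i j)
      (if-cong (≡.cong₂ _∨_ (allowed (splitAt n i)) (allowed (splitAt n j))))

    -- In the undirected case the factor `½` remains and is the one occurring in `γ`. Otherwise
    -- exchanging the sums shows that the transpose contributes a second copy of `edgeSum`, and
    -- halving cancels the doubling.
    half-sum-Δ : Allowed → ∀ undirected →
      half (sum⁺ λ i → sum⁺ λ j → Δ-entry undirected i j) ≈⁺
      [ if undirected then ½ * edgeSum else edgeSum ]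
    half-sum-Δ allowed true  =
      +⁺.reflexive (≡.cong half (sum⁺-finite F λ i → sum⁺-finite F λ j → D-allowed allowed i j))
    half-sum-Δ allowed false = +⁺.trans
      (+⁺.reflexive (≡.cong half (sum⁺-finite F λ i → sum⁺-finite F λ j →
        ≡.cong₂ _+⁺_ (D-allowed allowed i j) (D-allowed allowed j i))))
      [ trans (*-congˡ doubled) (½*[x⊕x]≈x F edgeSum) ]
      where
      doubled : (sum λ i → sum λ j → edgeEntry i j ⊕ edgeEntry j i) ≈ edgeSum ⊕ edgeSum
      doubled = trans
        (sum-cong-≋ λ i → ∑-distrib-+ (edgeEntry i) (λ j → edgeEntry j i))
        (trans (∑-distrib-+ (λ i → sum (edgeEntry i)) _) (+-congˡ (∑-comm (λ i j → edgeEntry j i))))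

    objective≈γ-path : ∀ {X} → Represents X → Allowed → objective X ≈⁺ [ γ path ]
    objective≈γ-path X-α allowed = +⁺.trans
      (objective-represented X-α)
      (+⁺.trans
        (+⁺.∙-cong (half-sum-Δ allowed (does bothUndirected?))
          (+⁺.reflexive (sum⁺-finite F λ i → ≡.trans (C-column i) (if-cong (allowed (splitAt n i))))))
        [ trans (+-comm _ _) (sym γ-path) ])

    permutationMatrix : Matrix ℕ (n + m) (m + n)
    permutationMatrix i k = if does (column i ≟ k) then 1 else 0

    permutationMatrix-represents : Represents permutationMatrix
    permutationMatrix-represents i =
      if-cong (dec-true (column i ≟ column i) ≡.refl) ,
      λ k k≢ → if-cong (dec-false (column i ≟ k) (k≢ ∘ ≡.sym))

    column-row : ∀ k → column (row k) ≡ k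
    column-row k = ≡.trans
      (≡.cong (join m n ∘ to) (splitAt-join n m (from (splitAt m k))))
      (≡.trans (≡.cong (join m n) (strictlyInverseˡ (splitAt m k))) (join-splitAt m n k))

    row-column : ∀ i → row (column i) ≡ i
    row-column i = ≡.trans
      (≡.cong (join n m ∘ from) (splitAt-join m n (to (splitAt n i))))
      (≡.trans (≡.cong (join n m) (strictlyInverseʳ (splitAt n i))) (join-splitAt n m i))

    permutationMatrix-isPermutationMatrix : IsPermutationMatrix permutationMatrix
    permutationMatrix-isPermutationMatrix =
      (λ i k → 0∨1 (does (column i ≟ k))) ,
      (λ i → ≡.trans (ℕΣ.sum-single (column i) (proj₂ (permutationMatrix-represents i)))
                     (proj₁ (permutationMatrix-represents i))) ,
      (λ k → ≡.trans
        -- `column` is injective with inverse `row`, so column `k` has its only 1 in row `row k`.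
        (ℕΣ.sum-single (row k) λ i i≢ → if-cong (dec-false (column i ≟ k)
          λ eq → i≢ (≡.trans (≡.sym (row-column i)) (≡.cong row eq))))
        (if-cong (dec-true (column (row k) ≟ k) (column-row k))))
      where
      0∨1 : ∀ b → (if b then 1 else 0) ≡ 0 ⊎ (if b then 1 else 0) ≡ 1
      0∨1 true  = inj₂ ≡.refl
      0∨1 false = inj₁ ≡.refl

  -- The position of the 1 in each row and in each column gives maps `σ` and `τ`. They are mutually
  -- inverse because an entry 1 found in a column must also be the single nonzero entry of its row,
  -- and conversely.
  represented : ∀ {X} → IsPermutationMatrix X → ∃[ α ] Represents α X
  represented {X} (_ , rows , columns) = mk↔ₛ′ to from to∘from from∘to , λ i →
    let open ≡.≡-Reasoning
        eq = begin
          join m n (to (splitAt n i))                      ≡⟨ join-splitAt m n _ ⟩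
          σ (join n m (splitAt n i))                       ≡⟨ ≡.cong σ (join-splitAt n m i) ⟩
          σ i                                              ∎
    in ≡.trans (≡.cong (X i) eq) (σ-one i) , λ k k≢ → σ-zero i k (k≢ ∘ flip ≡.trans (≡.sym eq))
    where
    σ : Fin (n + m) → Fin (m + n)
    σ i = proj₁ (sum≡1 (X i) (rows i))
    σ-one : ∀ i → X i (σ i) ≡ 1
    σ-one i = proj₁ (proj₂ (sum≡1 (X i) (rows i)))
    σ-zero : ∀ i k → k ≢ σ i → X i k ≡ 0
    σ-zero i = proj₂ (proj₂ (sum≡1 (X i) (rows i)))
    τ : Fin (m + n) → Fin (n + m)
    τ k = proj₁ (sum≡1 (transpose X k) (columns k))
    τ-one : ∀ k → X (τ k) k ≡ 1
    τ-one k = proj₁ (proj₂ (sum≡1 (transpose X k) (columns k)))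
    τ-zero : ∀ k i → i ≢ τ k → X i k ≡ 0
    τ-zero k = proj₂ (proj₂ (sum≡1 (transpose X k) (columns k)))

    στ : ∀ k → σ (τ k) ≡ k
    στ k with k ≟ σ (τ k)
    ... | yes eq = ≡.sym eq
    ... | no k≢  = contradiction (≡.trans (≡.sym (τ-one k)) (σ-zero (τ k) k k≢)) λ ()
    τσ : ∀ i → τ (σ i) ≡ i
    τσ i with i ≟ τ (σ i)
    ... | yes eq = ≡.sym eq
    ... | no i≢  = contradiction (≡.trans (≡.sym (σ-one i)) (τ-zero (σ i) i i≢)) λ ()

    to : V₁ᵋ → V₂ᵋ
    to x = splitAt m (σ (join n m x))
    from : V₂ᵋ → V₁ᵋ
    from y = splitAt n (τ (join m n y))
    to∘from : ∀ y → to (from y) ≡ y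
    to∘from y = ≡.trans (≡.cong (splitAt m ∘ σ) (join-splitAt n m _))
      (≡.trans (≡.cong (splitAt m) (στ (join m n y))) (splitAt-join m n y))
    from∘to : ∀ x → from (to x) ≡ x
    from∘to x = ≡.trans (≡.cong (splitAt n ∘ τ) (join-splitAt m n _))
      (≡.trans (≡.cong (splitAt n) (τσ (join n m x))) (splitAt-join n m x))

  -- The bijection of a restricted edit path.

  module Assignment (P : RestrictedEditPath G₁ G₂) where
    open RestrictedEditPath P

    source-unique : ∀ {o o′ x} → o ∈P → o′ ∈P → source o ≡ just x → source o′ ≡ just x → o ≡ o′
    source-unique {x = x} o∈ o′∈ s s′ with _ , _ , unique ← sources-once x (sources-valid o∈ s) =
      ≡.trans (≡.sym (unique (o∈ , s))) (unique (o′∈ , s′))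

    target-unique : ∀ {o o′ y} → o ∈P → o′ ∈P → target o ≡ just y → target o′ ≡ just y → o ≡ o′
    target-unique {y = y} o∈ o′∈ t t′ with _ , _ , unique ← targets-once y (targets-valid o∈ t) =
      ≡.trans (≡.sym (unique (o∈ , t))) (unique (o′∈ , t′))

    substitutedBy : Operation n m → Maybe (Fin m)
    substitutedBy (substituteNode i k) = just k
    substitutedBy _                    = nothing

    substituted : Operation n m → Maybe (Fin n)
    substituted (substituteNode i k) = just i
    substituted _                    = nothing

    image : Fin n → Maybe (Fin m)
    image i = substitutedBy (proj₁ (sources-once (node i) tt))

    preimage : Fin m → Maybe (Fin n)
    preimage k = substituted (proj₁ (targets-once (node k) tt))

    image-source : ∀ {o i} → o ∈P → source o ≡ just (node i) → image i ≡ substitutedBy o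
    image-source {i = i} o∈ s = ≡.cong substitutedBy
      (proj₂ (proj₂ (sources-once (node i) tt)) (o∈ , s))

    preimage-target : ∀ {o k} → o ∈P → target o ≡ just (node k) → preimage k ≡ substituted o
    preimage-target {k = k} o∈ t = ≡.cong substituted
      (proj₂ (proj₂ (targets-once (node k) tt)) (o∈ , t))

    image-just : ∀ {i k} → image i ≡ just k → substituteNode i k ∈P
    image-just {i} eq with sources-once (node i) tt
    image-just ≡.refl | substituteNode _ _ , (o∈ , ≡.refl) , _ = o∈

    preimage-just : ∀ {i k} → preimage k ≡ just i → substituteNode i k ∈P
    preimage-just {k = k} eq with targets-once (node k) tt
    preimage-just ≡.refl | substituteNode _ _ , (o∈ , ≡.refl) , _ = o∈

    -- A substitution of `i` by `k` is at once the unique operation on `i` and the unique operation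
    -- on `k`, so `image` and `preimage` invert each other where defined.
    α : V₁ᵋ ↔ V₂ᵋ
    α = completion image preimage
      (λ eq → preimage-target (image-just eq) ≡.refl)
      (λ eq → image-source (preimage-just eq) ≡.refl)

    open Path α

    -- The completion pairs an unmatched node with its own dummy only, and pairs of dummies are
    -- never forbidden.
    α-allowed : Allowed α
    α-allowed (inj₁ i) with image i
    ... | just _  = ≡.refl
    ... | nothing = ≡.cong not (dec-true (i ≟ i) ≡.refl)
    α-allowed (inj₂ k) with preimage k
    ... | just _  = ≡.refl
    ... | nothing = ≡.cong not (dec-true (k ≟ k) ≡.refl)

    nodeImage≡image : ∀ i → nodeImage i ≡ image i
    nodeImage≡image i with image i
    ... | just _  = ≡.refl
    ... | nothing = ≡.refl

    nodePreimage≡preimage : ∀ k → nodePreimage k ≡ preimage k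
    nodePreimage≡preimage k with preimage k
    ... | just _  = ≡.refl
    ... | nothing = ≡.refl

    nodeImage-just : ∀ {i k} → nodeImage i ≡ just k → substituteNode i k ∈P
    nodeImage-just {i} eq = image-just (≡.trans (≡.sym (nodeImage≡image i)) eq)

    nodePreimage-just : ∀ {i k} → nodePreimage k ≡ just i → substituteNode i k ∈P
    nodePreimage-just {k = k} eq = preimage-just (≡.trans (≡.sym (nodePreimage≡preimage k)) eq)

    -- Node operations are immediate, and edge substitutions follow from their endpoints. If a
    -- removed edge had an edge `f` as image, the operation of `P` on `f` would be a substitution,
    -- which then involves the removed edge a second time, or an insertion, which `no-reinsert`
    -- excludes. Insertions are treated symmetrically.
    member⇒inPath : ∀ o → o ∈P → InPath o
    member⇒inPath (substituteNode i k) o∈ = ≡.trans (nodeImage≡image i) (image-source o∈ ≡.refl)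
    member⇒inPath (removeNode i)       o∈ = ≡.trans (nodeImage≡image i) (image-source o∈ ≡.refl)
    member⇒inPath (insertNode k)       o∈ =
      ≡.trans (nodePreimage≡preimage k) (preimage-target o∈ ≡.refl)
    member⇒inPath (substituteEdge (i , j) (k , l)) o∈ with ik∈ , jl∈ ← endpoints o∈ =
      sources-valid o∈ ≡.refl ,
      edgeImage-edge (member⇒inPath (substituteNode i k) ik∈) (member⇒inPath (substituteNode j l) jl∈)
        (targets-valid o∈ ≡.refl)
    member⇒inPath (removeEdge e) o∈ = sources-valid o∈ ≡.refl , no-image
      where
      no-image : edgeImage e ≡ nothing
      no-image with edgeImage e in eq
      ... | nothing = ≡.refl
      ... | just f with p , q , f∈ ← edgeImage-just eq with targets-once (couple f) f∈
      ...   | substituteEdge e′ _ , (o′∈ , ≡.refl) , _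
            with e′∈ , eq′ ← member⇒inPath (substituteEdge e′ f) o′∈
            -- `edgePreimage f` is both `just e′` and `just e`, so the edge substituted by `f` is
            -- the removed one.
            with ≡.refl ← Maybe.just-injective (≡.trans (≡.sym (edgePreimage-image e′∈ eq′))
                            (edgePreimage-image (sources-valid o∈ ≡.refl) eq))
            = contradiction (source-unique o∈ o′∈ ≡.refl ≡.refl) λ ()
      ...   | insertEdge _ , (o′∈ , ≡.refl) , _ =
        contradiction o′∈ (no-reinsert (nodeImage-just p) (nodeImage-just q) o∈ f∈)
    member⇒inPath (insertEdge f) o∈ = targets-valid o∈ ≡.refl , no-preimage
      where
      no-preimage : edgePreimage f ≡ nothing
      no-preimage with edgePreimage f in eq
      ... | nothing = ≡.refl
      ... | just e with p , q , e∈ ← edgePreimage-just eq with sources-once (couple e) e∈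
      ...   | substituteEdge _ f′ , (o′∈ , ≡.refl) , _
            with _ , eq′ ← member⇒inPath (substituteEdge e f′) o′∈
            with ≡.refl ← Maybe.just-injective (≡.trans (≡.sym eq′)
                            (edgeImage-preimage (targets-valid o∈ ≡.refl) eq))
            = contradiction (target-unique o∈ o′∈ ≡.refl ≡.refl) λ ()
      -- Here `no-reinsert` is used from the other side: the preimage `e` is removed, so `f` cannot
      -- be inserted.
      ...   | removeEdge _ , (o′∈ , ≡.refl) , _ =
        contradiction o∈ (no-reinsert (nodePreimage-just p) (nodePreimage-just q) o′∈
          (targets-valid o∈ ≡.refl))

    -- P contains an operation with the same source as o; it lies in the
    -- path of α, where sources are unique, so it is o.
    source-member : ∀ {o x} → InPath o → source o ≡ just x → o ∈P
    source-member {o} {x} p s with o′ , (o′∈ , s′) , _ ← sources-once x (inPath-source o p s) =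
      ≡.subst _∈P (≡.trans (≡.sym (operationFrom-unique o′ (member⇒inPath o′ o′∈) s′))
                           (operationFrom-unique o p s)) o′∈

    target-member : ∀ {o y} → InPath o → target o ≡ just y → o ∈P
    target-member {o} {y} p t with o′ , (o′∈ , t′) , _ ← targets-once y (inPath-target o p t) =
      ≡.subst _∈P (≡.trans (≡.sym (operationTo-unique o′ (member⇒inPath o′ o′∈) t′))
                           (operationTo-unique o p t)) o′∈

    inPath⇒member : ∀ o → InPath o → o ∈P
    inPath⇒member o@(substituteNode _ _) p = source-member {o} p ≡.refl
    inPath⇒member o@(removeNode _)       p = source-member {o} p ≡.refl
    inPath⇒member o@(insertNode _)       p = target-member {o} p ≡.refl
    inPath⇒member o@(substituteEdge _ _) p = source-member {o} p ≡.refl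
    inPath⇒member o@(removeEdge _)       p = source-member {o} p ≡.refl
    inPath⇒member o@(insertEdge _)       p = target-member {o} p ≡.refl

    costInP-path : ∀ o → costInP P o ≈ costInP path o
    costInP-path o = reflexive (if-cong (≡.sym
      (does≡ (inPath? o) (mk⇔ (member⇒inPath o) (inPath⇒member o)))))

    γ≈γ-path : γ P ≈ γ path
    γ≈γ-path = +-cong
      (+-cong (+-cong
        (sum-cong-≋ λ i → sum-cong-≋ λ k → costInP-path (substituteNode i k))
        (sum-cong-≋ λ i → costInP-path (removeNode i)))
        (sum-cong-≋ λ k → costInP-path (insertNode k)))
      (if-½-cong (does bothUndirected?) edge≈)
      where
      edge≈ : edgeOperationsCost P ≈ edgeOperationsCost path
      edge≈ = +-cong (+-cong
        (sumCouples-cong λ e → sumCouples-cong λ f → costInP-path (substituteEdge e f))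
        (sumCouples-cong λ e → costInP-path (removeEdge e)))
        (sumCouples-cong λ f → costInP-path (insertEdge f))

    γ≈objective : [ γ P ] ≈⁺ objective (permutationMatrix α)
    γ≈objective = +⁺.trans [ γ≈γ-path ]
      (+⁺.sym (objective≈γ-path α (permutationMatrix-represents α) α-allowed))

-- The two directions of the correspondence.

proposition8 : ∀ {c ℓ₁ ℓ₂ ℓ₃} (F : OrderedField c ℓ₁ ℓ₂ ℓ₃)
    {n m q : ℕ} (G₁ : Graph n q) (G₂ : Graph m q) (𝒞 : Costs F G₁ G₂) →
    let open EditDistance F G₁ G₂ 𝒞 in
    ((X : Matrix ℕ (n + m) (m + n)) → IsPermutationMatrix X →
    objective X ≢ ⊤⁺ →
    ∃[ P ] (objective X ≈⁺ [ γ P ]))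
    ×
    ((P : RestrictedEditPath G₁ G₂) →
    ∃[ X ] (IsPermutationMatrix X × [ γ P ] ≈⁺ objective X))
proposition8 F G₁ G₂ 𝒞 =
  (λ X X-perm finite →
    let α , X-α = represented X-perm in
    Path.path α , objective≈γ-path α X-α (finite⇒allowed α X-α finite)) ,
  λ P → let open Assignment P in
    permutationMatrix α , permutationMatrix-isPermutationMatrix α , γ≈objective
  where open EditPaths F G₁ G₂ 𝒞
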